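{- Let $G$ be a connected graph of order $n \ge 3$ with minimum degree $\delta \ge 2$ and maximum degree $\Delta$. Then \[ \gamma_{\rm it}^{\rm g}(G) \le \left( \frac{2\delta-1}{3\delta-2} \right) n - \frac{\Delta - 2}{3\delta-2}, \] where $\gamma_{\rm it}^{\rm g}(G)$ denotes the game total isolation number of $G$ (Dominator-start).
   Context: All graphs are finite and simple. For a vertex set $S$, $N_G(S)$ denotes the set of vertices adjacent to at least one vertex of $S$ (open neighborhood), and $G - X$ is the graph obtained by deleting the vertices of $X$. The total isolation game on a graph $G$ is played by two players, Dominator and Staller, who alternately select vertices of $G$. If $S$ is the set of vertices selected so far, a vertex $v$ may be selected (is playable) only if $v$ is adjacent to some vertex $u$ such that either $u$ belongs to a component of $G - N_G(S)$ of order at least $2$, or $u \in S$ and $u$ is an isolated vertex of $G - N_G(S)$. The game ends when no playable vertex exists. Dominator aims to minimize the total number of selected vertices, Staller aims to maximize it. The game total isolation number $\gamma_{\rm it}^{\rm g}(G)$ is the number of moves in the game in which Dominator makes the first move and both players play optimally. -}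

module Defs where

open import Data.Nat using (ℕ; zero; suc; _≤_)
open import Data.Bool using (Bool; true; false)
open import Data.Fin using (Fin)
open import Data.Fin.Subset using (Subset; _∈_; _∪_; ⁅_⁆; ∣_∣; ⊥)
open import Data.Vec using (tabulate)
open import Data.Product using (Σ; ∃; _×_)
open import Data.Sum using (_⊎_)
open import Data.Unit using (⊤)
open import Relation.Nullary using (¬_)
open import Relation.Binary.PropositionalEquality using (_≡_; _≢_)

record Graph (n : ℕ) : Set where
  field
    adj   : Fin n → Fin n → Bool
    sym   : ∀ u v → adj u v ≡ adj v u
    loopless : ∀ v → adj v v ≡ false
open Graph public

module _ {n : ℕ} (G : Graph n) where

  Adj : Fin n → Fin n → Set
  Adj u v = adj G u v ≡ true

  deg : Fin n → ℕ
  deg v = ∣ tabulate (adj G v) ∣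

  IsMinDegree : ℕ → Set
  IsMinDegree d = (∀ v → d ≤ deg v) × ∃ λ v → deg v ≡ d

  IsMaxDegree : ℕ → Set
  IsMaxDegree d = (∀ v → deg v ≤ d) × ∃ λ v → deg v ≡ d

  data Walk (P : Fin n → Set) : Fin n → Fin n → Set where
    here : ∀ {u} → Walk P u u
    step : ∀ {u w x} → Adj u w → P w → Walk P w x → Walk P u x

  Connected : Set
  Connected = ∀ u v → Walk (λ _ → ⊤) u v

  InN : Subset n → Fin n → Set
  InN S u = ∃ λ w → w ∈ S × Adj w u

  Rem : Subset n → Fin n → Set
  Rem S u = ¬ InN S u

  InBigComponent : Subset n → Fin n → Set
  InBigComponent S u = Rem S u × ∃ λ x → x ≢ u × Walk (Rem S) u x

  IsolatedIn : Subset n → Fin n → Set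
  IsolatedIn S u = Rem S u × (∀ w → Rem S w → ¬ Adj u w)

  Playable : Subset n → Fin n → Set
  Playable S v = ∃ λ u → Adj v u × (InBigComponent S u ⊎ (u ∈ S × IsolatedIn S u))

  GameOver : Subset n → Set
  GameOver S = ∀ v → ¬ Playable S v

  -- DomCan S k : from position S with Dominator to move, Dominator has a
  -- strategy ensuring that at most k further moves are played (whatever Staller does).
  -- StaCan S k : same, with Staller to move.
  data DomCan : Subset n → ℕ → Set
  data StaCan : Subset n → ℕ → Set

  data DomCan where
    dEnd  : ∀ {S k} → GameOver S → DomCan S k
    dMove : ∀ {S k} v → Playable S v → StaCan (S ∪ ⁅ v ⁆) k → DomCan S (suc k)

  data StaCan where
    sEnd  : ∀ {S k} → GameOver S → StaCan S k
    sMove : ∀ {S k} → (∀ v → Playable S v → DomCan (S ∪ ⁅ v ⁆) k) → StaCan S (suc k)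

  GameTotIsoAtMost : ℕ → Set
  GameTotIsoAtMost k = DomCan ⊥ k

{-# OPTIONS --safe #-}
-- Call an undominated vertex live if it has an undominated neighbour or has been
-- selected.  Every move dominates a live vertex and creates none, so at most m
-- moves remain when m vertices are live.  Dominator opens with a vertex of degree
-- Δ and then, as long as possible, dominates two new vertices per move.  At the
-- first turn where this is impossible, after k moves, every vertex adjacent to a
-- live vertex is unselected and has that vertex as its only undominated
-- neighbour, so δ m ≤ n − k, while the counts of dominated vertices give
-- 3 k + 2 (Δ − 2) ≤ 2 (n − m).  Adding δ − 1 times the second inequality to the
-- first bounds k + m.
module Submission where

open import Defs hiding (sym)
open import Data.Bool using (Bool; true)
import Data.Bool.Properties as Bool
open import Data.Empty using (⊥-elim)
open import Data.Fin using (Fin; zero; suc)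
import Data.Fin.Properties as Fin
open import Data.Fin.Subset
  using (Subset; inside; outside; _∈_; _∉_; _⊆_; _⊂_; _∪_; _─_; _-_; ⁅_⁆; ∁; ∣_∣; ⊥; Nonempty)
open import Data.Fin.Subset.Properties
open import Data.Nat using (ℕ; zero; suc; _≤_; _<_; _*_; _+_; _∸_; _/_; z≤n; s≤s)
open import Data.Nat.DivMod using (m/n*n≤m; m*n/n≡m; /-monoˡ-≤)
open import Data.Nat.Properties
open import Data.Nat.Tactic.RingSolver using (solve-∀)
open import Data.Product using (∃; _×_; _,_; proj₁; proj₂)
open import Data.Sum using (_⊎_; inj₁; inj₂)
open import Data.Vec using ([]; _∷_; tabulate; here; there)
open import Data.Vec.Properties using (lookup⇒[]=; []=⇒lookup; lookup∘tabulate)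
open import Function using (_∘_)
open import Relation.Binary.PropositionalEquality
  using (_≡_; _≢_; refl; sym; trans; cong; subst; subst₂)
open import Relation.Nullary using (¬_; Dec; yes; no; does; _×-dec_; _⊎-dec_; ¬?)
open import Relation.Nullary.Decidable using (dec-true; map′)
open import Relation.Unary using (Decidable)

-- Decidable subsets and counting.

∈-tabulate⁺ : ∀ {n} (f : Fin n → Bool) {i} → f i ≡ true → i ∈ tabulate f
∈-tabulate⁺ f {i} fi = lookup⇒[]= i _ (trans (lookup∘tabulate f i) fi)

∈-tabulate⁻ : ∀ {n} (f : Fin n → Bool) {i} → i ∈ tabulate f → f i ≡ true
∈-tabulate⁻ f {i} i∈ = trans (sym (lookup∘tabulate f i)) ([]=⇒lookup i∈)

module _ {n} {P : Fin n → Set} (P? : Decidable P) where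

  ⟪_⟫ : Subset n
  ⟪_⟫ = tabulate (does ∘ P?)

  ∈-⟪⟫⁺ : ∀ {i} → P i → i ∈ ⟪_⟫
  ∈-⟪⟫⁺ {i} pi = ∈-tabulate⁺ (does ∘ P?) (dec-true (P? i) pi)

  ∈-⟪⟫⁻ : ∀ {i} → i ∈ ⟪_⟫ → P i
  ∈-⟪⟫⁻ {i} i∈ with P? i | ∈-tabulate⁻ (does ∘ P?) i∈
  ... | yes pi | _ = pi

∣p∣>0⇒Nonempty : ∀ {n} (p : Subset n) → 0 < ∣ p ∣ → Nonempty p
∣p∣>0⇒Nonempty {n} p 0<∣p∣ with nonempty? p
... | yes ne = ne
... | no  em = ⊥-elim (<-irrefl (sym (trans (cong ∣_∣ (Empty-unique em)) (∣⊥∣≡0 n))) 0<∣p∣)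

∣p∣+∣q─p∣≤∣q∣ : ∀ {n} (p q : Subset n) → p ⊆ q → ∣ p ∣ + ∣ q ─ p ∣ ≤ ∣ q ∣
∣p∣+∣q─p∣≤∣q∣ []            []            _   = z≤n
∣p∣+∣q─p∣≤∣q∣ (outside ∷ p) (outside ∷ q) p⊆q = ∣p∣+∣q─p∣≤∣q∣ p q (drop-∷-⊆ p⊆q)
∣p∣+∣q─p∣≤∣q∣ (outside ∷ p) (inside  ∷ q) p⊆q =
  subst (_≤ suc ∣ q ∣) (sym (+-suc ∣ p ∣ _)) (s≤s (∣p∣+∣q─p∣≤∣q∣ p q (drop-∷-⊆ p⊆q)))
∣p∣+∣q─p∣≤∣q∣ (inside  ∷ p) (inside  ∷ q) p⊆q = s≤s (∣p∣+∣q─p∣≤∣q∣ p q (drop-∷-⊆ p⊆q))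
∣p∣+∣q─p∣≤∣q∣ (inside  ∷ p) (outside ∷ q) p⊆q with p⊆q here
... | ()

disjoint⇒∣p∣+∣q∣≤n : ∀ {n} (p q : Subset n) → (∀ {x} → x ∈ p → x ∉ q) → ∣ p ∣ + ∣ q ∣ ≤ n
disjoint⇒∣p∣+∣q∣≤n {n} p q disj = begin
  ∣ p ∣ + ∣ q ∣     ≤⟨ +-monoˡ-≤ ∣ q ∣ (p⊆q⇒∣p∣≤∣q∣ (x∉p⇒x∈∁p ∘ disj)) ⟩
  ∣ ∁ q ∣ + ∣ q ∣   ≡⟨ cong (_+ ∣ q ∣) (∣∁p∣≡n∸∣p∣ q) ⟩
  n ∸ ∣ q ∣ + ∣ q ∣ ≡⟨ m∸n+n≡m (∣p∣≤n q) ⟩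
  n                 ∎
  where open ≤-Reasoning

-- Removing the first chosen set from `q` leaves room for all the others, by disjointness; induct on
-- the index set.
disjointFamily : ∀ {m n} d (A : Fin m → Subset n) (p : Subset m) (q : Subset n) →
  (∀ {i} → i ∈ p → d ≤ ∣ A i ∣) →
  (∀ {i} → i ∈ p → A i ⊆ q) →
  (∀ {i j x} → i ∈ p → j ∈ p → x ∈ A i → x ∈ A j → i ≡ j) →
  d * ∣ p ∣ ≤ ∣ q ∣
disjointFamily d A [] q large sub disj = ≤-trans (≤-reflexive (*-zeroʳ d)) z≤n
disjointFamily d A (outside ∷ p) q large sub disj =
  disjointFamily d (A ∘ suc) p q (large ∘ there) (sub ∘ there)
    (λ i∈ j∈ x∈ y∈ → Fin.suc-injective (disj (there i∈) (there j∈) x∈ y∈))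
disjointFamily d A (inside ∷ p) q large sub disj = begin
  d * suc ∣ p ∣                   ≡⟨ *-suc d ∣ p ∣ ⟩
  d + d * ∣ p ∣                   ≤⟨ +-mono-≤ (large here) rest ⟩
  ∣ A zero ∣ + ∣ q ─ A zero ∣     ≤⟨ ∣p∣+∣q─p∣≤∣q∣ (A zero) q (sub here) ⟩
  ∣ q ∣                           ∎
  where
  open ≤-Reasoning
  rest : d * ∣ p ∣ ≤ ∣ q ─ A zero ∣
  rest = disjointFamily d (A ∘ suc) p (q ─ A zero) (large ∘ there)
    (λ i∈ x∈ → x∈p∧x∉q⇒x∈p─q (sub (there i∈) x∈)
      λ x∈₀ → Fin.0≢1+n (disj here (there i∈) x∈₀ x∈))
    (λ i∈ j∈ x∈ y∈ → Fin.suc-injective (disj (there i∈) (there j∈) x∈ y∈))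

-- Live vertices and legal moves.

module _ {n : ℕ} (G : Graph n) where

  Adj? : ∀ u v → Dec (Adj G u v)
  Adj? u v = adj G u v Bool.≟ true

  Adj-sym : ∀ {u v} → Adj G u v → Adj G v u
  Adj-sym {u} {v} = trans (Graph.sym G v u)

  Adj⇒≢ : ∀ {u v} → Adj G u v → u ≢ v
  Adj⇒≢ {u} uv refl with trans (sym uv) (loopless G u)
  ... | ()

  InN? : ∀ S → Decidable (InN G S)
  InN? S u = Fin.any? λ w → (w ∈? S) ×-dec Adj? w u

  Rem? : ∀ S → Decidable (Rem G S)
  Rem? S = ¬? ∘ InN? S

  -- A local form of the rule of the game: an undominated vertex lies in a component of order at
  -- least 2 exactly when it has an undominated neighbour. A selected undominated vertex that is not
  -- isolated falls under the first alternative, so the legal moves are the same.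
  Live : Subset n → Fin n → Set
  Live S u = Rem G S u × ((∃ λ w → Rem G S w × Adj G u w) ⊎ u ∈ S)

  Live? : ∀ S → Decidable (Live S)
  Live? S u = Rem? S u ×-dec (Fin.any? (λ w → Rem? S w ×-dec Adj? u w) ⊎-dec (u ∈? S))

  Live⇒Playable : ∀ {S u v} → Adj G v u → Live S u → Playable G S v
  Live⇒Playable {u = u} vu (ru , inj₁ (w , rw , uw)) =
    u , vu , inj₁ (ru , w , Adj⇒≢ (Adj-sym uw) , step uw rw here)
  Live⇒Playable {S} {u} vu (ru , inj₂ u∈S) with Fin.any? (λ w → Rem? S w ×-dec Adj? u w)
  ... | yes nb = Live⇒Playable vu (ru , inj₁ nb)
  ... | no ¬nb = u , vu , inj₂ (u∈S , ru , λ w rw uw → ¬nb (w , rw , uw))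

  Playable⇒Live : ∀ {S v} → Playable G S v → ∃ λ u → Adj G v u × Live S u
  Playable⇒Live (u , vu , inj₁ (ru , x , x≢u , here)) = ⊥-elim (x≢u refl)
  Playable⇒Live (u , vu , inj₁ (ru , x , x≢u , step uw rw _)) = u , vu , ru , inj₁ (_ , rw , uw)
  Playable⇒Live (u , vu , inj₂ (u∈S , ru , _)) = u , vu , ru , inj₂ u∈S

  Playable? : ∀ S → Decidable (Playable G S)
  Playable? S v = map′ (λ (_ , vu , lu) → Live⇒Playable vu lu) Playable⇒Live
    (Fin.any? λ u → Adj? v u ×-dec Live? S u)

  N L : Subset n → Subset n
  N S = ⟪ InN? S ⟫
  L S = ⟪ Live? S ⟫

  InN-∪ : ∀ {S u} v → InN G S u → InN G (S ∪ ⁅ v ⁆) u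
  InN-∪ v (w , w∈S , wu) = w , p⊆p∪q ⁅ v ⁆ w∈S , wu

  Adj⇒InN : ∀ {S u v} → Adj G v u → InN G (S ∪ ⁅ v ⁆) u
  Adj⇒InN {S} {v = v} vu = v , q⊆p∪q S _ (x∈⁅x⁆ v) , vu

  N-mono : ∀ S v → N S ⊆ N (S ∪ ⁅ v ⁆)
  N-mono S v x∈ = ∈-⟪⟫⁺ (InN? _) (InN-∪ v (∈-⟪⟫⁻ (InN? S) x∈))

  module _ {S : Subset n} {v : Fin n} (pl : Playable G S v) where

    -- All neighbours of a selected vertex are dominated, whereas a playable vertex has an
    -- undominated one.
    Playable⇒∉ : v ∉ S
    Playable⇒∉ v∈S with Playable⇒Live pl
    ... | u , vu , ru , _ = ru (v , v∈S , vu)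

    ∣S∣<∣S∪v∣ : ∣ S ∣ < ∣ S ∪ ⁅ v ⁆ ∣
    ∣S∣<∣S∪v∣ = p⊂q⇒∣p∣<∣q∣ (p⊆p∪q ⁅ v ⁆ , v , q⊆p∪q S _ (x∈⁅x⁆ v) , Playable⇒∉)

    ∣N∣-increases : ∣ N S ∣ < ∣ N (S ∪ ⁅ v ⁆) ∣
    ∣N∣-increases with Playable⇒Live pl
    ... | u , vu , ru , _ = p⊂q⇒∣p∣<∣q∣
      (N-mono S v , u , ∈-⟪⟫⁺ (InN? _) (Adj⇒InN vu) , ru ∘ ∈-⟪⟫⁻ (InN? S))

    -- If v itself is undominated, it was live already: its undominated neighbour
    -- that makes v playable lies in the same component.
    Live-shrinks : ∀ {x} → Live (S ∪ ⁅ v ⁆) x → Live S x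
    Live-shrinks (rx , inj₁ (w , rw , xw)) = rx ∘ InN-∪ v , inj₁ (w , rw ∘ InN-∪ v , xw)
    Live-shrinks {x} (rx , inj₂ x∈) with x∈p∪q⁻ S ⁅ v ⁆ x∈
    ... | inj₁ x∈S = rx ∘ InN-∪ v , inj₂ x∈S
    ... | inj₂ x∈v with x∈⁅y⁆⇒x≡y v x∈v | Playable⇒Live pl
    ... | refl | u , vu , ru , _ = rx ∘ InN-∪ v , inj₁ (u , ru , vu)

    ∣L∣-decreases : ∣ L (S ∪ ⁅ v ⁆) ∣ < ∣ L S ∣
    ∣L∣-decreases with Playable⇒Live pl
    ... | u , vu , lu = p⊂q⇒∣p∣<∣q∣
      ( (λ x∈ → ∈-⟪⟫⁺ (Live? S) (Live-shrinks (∈-⟪⟫⁻ (Live? _) x∈)))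
      , u , ∈-⟪⟫⁺ (Live? S) lu , λ u∈ → proj₁ (∈-⟪⟫⁻ (Live? _) u∈) (Adj⇒InN vu))

  -- The number of live vertices is a potential that every legal move lowers, so Dominator may play
  -- anything.
  domEndgame : ∀ ℓ S → ∣ L S ∣ ≤ ℓ → DomCan G S ℓ
  staEndgame : ∀ ℓ S → ∣ L S ∣ ≤ ℓ → StaCan G S ℓ

  domEndgame ℓ S L≤ with Fin.any? (Playable? S)
  domEndgame ℓ S L≤ | no over = dEnd λ v pl → over (v , pl)
  domEndgame zero S L≤ | yes (v , pl) = ⊥-elim (<⇒≱ (≤-trans (∣L∣-decreases pl) L≤) z≤n)
  domEndgame (suc ℓ) S L≤ | yes (v , pl) =
    dMove v pl (staEndgame ℓ _ (≤-pred (≤-trans (∣L∣-decreases pl) L≤)))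

  staEndgame zero S L≤ = sEnd λ v pl → <⇒≱ (≤-trans (∣L∣-decreases pl) L≤) z≤n
  staEndgame (suc ℓ) S L≤ =
    sMove λ v pl → domEndgame ℓ _ (≤-pred (≤-trans (∣L∣-decreases pl) L≤))

  -- Dominator's greedy phase.

  -- The two neighbours have different roles: `u` makes the move legal, `w` is a second vertex that
  -- it newly dominates.
  Forked : Subset n → Fin n → Set
  Forked S v = ∃ λ u → ∃ λ w → (Adj G v u × Live S u) × (Adj G v w × Rem G S w) × u ≢ w

  Forked? : ∀ S → Decidable (Forked S)
  Forked? S v = Fin.any? λ u → Fin.any? λ w →
    (Adj? v u ×-dec Live? S u) ×-dec (Adj? v w ×-dec Rem? S w) ×-dec ¬? (u Fin.≟ w)

  Forked⇒Playable : ∀ {S v} → Forked S v → Playable G S v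
  Forked⇒Playable (_ , _ , (vu , lu) , _) = Live⇒Playable vu lu

  Forked⇒∣N∣+2≤ : ∀ {S v} → Forked S v → 2 + ∣ N S ∣ ≤ ∣ N (S ∪ ⁅ v ⁆) ∣
  Forked⇒∣N∣+2≤ {S} {v} (u , w , (vu , ru , _) , (vw , rw) , u≢w) =
    ≤-trans (s≤s (p⊂q⇒∣p∣<∣q∣ NS⊂)) (x∈p⇒∣p-x∣<∣p∣ (∈-⟪⟫⁺ (InN? _) (Adj⇒InN vw)))
    where
    -- Each new vertex accounts for one strict inequality: `u` lies outside `N S`, and `w` is put
    -- back afterwards.
    NS⊂ : N S ⊂ N (S ∪ ⁅ v ⁆) - w
    NS⊂ = (λ x∈ → x∈p∧x≢y⇒x∈p-y (N-mono S v x∈) λ { refl → rw (∈-⟪⟫⁻ (InN? S) x∈) })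
        , u , x∈p∧x≢y⇒x∈p-y (∈-⟪⟫⁺ (InN? _) (Adj⇒InN vu)) u≢w , ru ∘ ∈-⟪⟫⁻ (InN? S)

  ∣N∣+∣L∣≤n : ∀ S → ∣ N S ∣ + ∣ L S ∣ ≤ n
  ∣N∣+∣L∣≤n S = disjoint⇒∣p∣+∣q∣≤n (N S) (L S)
    λ x∈N x∈L → proj₁ (∈-⟪⟫⁻ (Live? S) x∈L) (∈-⟪⟫⁻ (InN? S) x∈N)

  -- The open neighbourhoods of live vertices have size at least `δ`, avoid `S` because live
  -- vertices are undominated, and are pairwise disjoint because a common neighbour would be forked.
  ¬Forked⇒δ∣L∣+∣S∣≤n : ∀ {δ} S → (∀ v → δ ≤ deg G v) → (∀ v → ¬ Forked S v) →
    δ * ∣ L S ∣ + ∣ S ∣ ≤ n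
  ¬Forked⇒δ∣L∣+∣S∣≤n {δ} S δ≤ unforked = begin
    δ * ∣ L S ∣ + ∣ S ∣ ≤⟨ +-monoˡ-≤ ∣ S ∣ (disjointFamily δ (tabulate ∘ adj G) (L S) (∁ S)
                             (λ {u} _ → δ≤ u) avoidsS disjoint) ⟩
    ∣ ∁ S ∣ + ∣ S ∣     ≤⟨ disjoint⇒∣p∣+∣q∣≤n (∁ S) S x∈∁p⇒x∉p ⟩
    n                   ∎
    where
    open ≤-Reasoning
    avoidsS : ∀ {u} → u ∈ L S → tabulate (adj G u) ⊆ ∁ S
    avoidsS {u} u∈L x∈ = x∉p⇒x∈∁p λ x∈S →
      proj₁ (∈-⟪⟫⁻ (Live? S) u∈L) (_ , x∈S , Adj-sym (∈-tabulate⁻ (adj G u) x∈))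
    disjoint : ∀ {u w x} → u ∈ L S → w ∈ L S →
      x ∈ tabulate (adj G u) → x ∈ tabulate (adj G w) → u ≡ w
    disjoint {u} {w} {x} u∈L w∈L x∈u x∈w with u Fin.≟ w
    ... | yes u≡w = u≡w
    ... | no  u≢w = ⊥-elim (unforked x
      ( u , w
      , (Adj-sym (∈-tabulate⁻ (adj G u) x∈u) , ∈-⟪⟫⁻ (Live? S) u∈L)
      , (Adj-sym (∈-tabulate⁻ (adj G w) x∈w) , proj₁ (∈-⟪⟫⁻ (Live? S) w∈L))
      , u≢w))

  -- K caps every length t that the two counting inequalities allow, where
  -- e = δ − 1, c = Δ − 2, and m is the number of live vertices when Dominator's
  -- greedy phase ends.
  module Greedy (e c K : ℕ) (δ≤deg : ∀ v → suc e ≤ deg G v)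
    (cap : ∀ t m → 3 * t + 2 * c ≤ 2 * n + m → t + e * m ≤ n → t ≤ K) where

    -- The case `m = 0` of `cap`: during the greedy phase the number of moves made never exceeds
    -- `K`.
    cap₀ : ∀ t S → t ≤ ∣ S ∣ → 3 * t + 2 * c ≤ 2 * ∣ N S ∣ → t ≤ K
    cap₀ t S t≤ inv = cap t 0
      (≤-trans inv (≤-trans (*-monoʳ-≤ 2 (∣p∣≤n (N S))) (m≤m+n (2 * n) 0)))
      (subst (_≤ n) (sym (trans (cong (t +_) (*-zeroʳ e)) (+-identityʳ t)))
        (≤-trans t≤ (∣p∣≤n S)))

    -- `k` counts the moves made, `ℓ` those still allowed. A greedy move raises `2 * ∣ N S ∣` by at
    -- least 4 and a move of Staller by at least 2, against 3 charged per move; the extra 1 in `sta`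
    -- is the surplus from Dominator's move.
    dom : ∀ ℓ k S → k + ℓ ≡ K → k ≤ ∣ S ∣ → 3 * k + 2 * c ≤ 2 * ∣ N S ∣ → DomCan G S ℓ
    sta : ∀ ℓ k S → k + ℓ ≡ K → k ≤ ∣ S ∣ → 1 + (3 * k + 2 * c) ≤ 2 * ∣ N S ∣ → StaCan G S ℓ

    dom ℓ k S k+ℓ k≤ inv with Fin.any? (Forked? S)
    -- Taking `t = k + m` in `cap` shows that the remaining budget `ℓ` covers the `m` live vertices.
    ... | no none = domEndgame ℓ S (+-cancelˡ-≤ k _ _ (subst (k + m ≤_) (sym k+ℓ)
                      (cap (k + m) m domBound liveBound)))
      where
      open ≤-Reasoning
      m = ∣ L S ∣
      domBound : 3 * (k + m) + 2 * c ≤ 2 * n + m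
      domBound = begin
        3 * (k + m) + 2 * c          ≡⟨ eq₁ k m c ⟩
        3 * k + 2 * c + 3 * m        ≤⟨ +-monoˡ-≤ (3 * m) inv ⟩
        2 * ∣ N S ∣ + 3 * m          ≡⟨ eq₂ ∣ N S ∣ m ⟩
        2 * (∣ N S ∣ + m) + m        ≤⟨ +-monoˡ-≤ m (*-monoʳ-≤ 2 (∣N∣+∣L∣≤n S)) ⟩
        2 * n + m                    ∎
        where
        eq₁ : ∀ k m c → 3 * (k + m) + 2 * c ≡ 3 * k + 2 * c + 3 * m
        eq₁ = solve-∀
        eq₂ : ∀ d m → 2 * d + 3 * m ≡ 2 * (d + m) + m
        eq₂ = solve-∀
      liveBound : k + m + e * m ≤ n
      liveBound = begin
        k + m + e * m         ≡⟨ eq k m e ⟩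
        suc e * m + k         ≤⟨ +-monoʳ-≤ (suc e * m) k≤ ⟩
        suc e * m + ∣ S ∣     ≤⟨ ¬Forked⇒δ∣L∣+∣S∣≤n S δ≤deg (λ v f → none (v , f)) ⟩
        n                     ∎
        where
        eq : ∀ k m e → k + m + e * m ≡ suc e * m + k
        eq = solve-∀
    ... | yes (v , f) = move ℓ k+ℓ
      where
      S′ = S ∪ ⁅ v ⁆
      pl = Forked⇒Playable f
      k< : suc k ≤ ∣ S′ ∣
      k< = ≤-trans (s≤s k≤) (∣S∣<∣S∪v∣ pl)
      inv′ : 1 + (3 * suc k + 2 * c) ≤ 2 * ∣ N S′ ∣
      inv′ = begin
        1 + (3 * suc k + 2 * c) ≡⟨ eq k c ⟩
        4 + (3 * k + 2 * c)     ≤⟨ +-monoʳ-≤ 4 inv ⟩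
        4 + 2 * ∣ N S ∣         ≡⟨ *-distribˡ-+ 2 2 ∣ N S ∣ ⟨
        2 * (2 + ∣ N S ∣)       ≤⟨ *-monoʳ-≤ 2 (Forked⇒∣N∣+2≤ f) ⟩
        2 * ∣ N S′ ∣            ∎
        where
        open ≤-Reasoning
        eq : ∀ k c → 1 + (3 * suc k + 2 * c) ≡ 4 + (3 * k + 2 * c)
        eq = solve-∀
      move : ∀ ℓ → k + ℓ ≡ K → DomCan G S ℓ
      -- An exhausted budget means `k = K`, but the position after the forked move gives
      -- `suc k ≤ K`.
      move zero    eq = ⊥-elim (<-irrefl (trans (sym (+-identityʳ k)) eq)
                          (cap₀ (suc k) S′ k< (m+n≤o⇒n≤o 1 inv′)))
      move (suc ℓ) eq = dMove v pl (sta ℓ (suc k) S′ (trans (sym (+-suc k ℓ)) eq) k< inv′)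

    sta ℓ k S k+ℓ k≤ inv = move ℓ k+ℓ
      where
      module _ {v} (pl : Playable G S v) where
        k< : suc k ≤ ∣ S ∪ ⁅ v ⁆ ∣
        k< = ≤-trans (s≤s k≤) (∣S∣<∣S∪v∣ pl)
        inv′ : 3 * suc k + 2 * c ≤ 2 * ∣ N (S ∪ ⁅ v ⁆) ∣
        inv′ = begin
          3 * suc k + 2 * c             ≡⟨ eq k c ⟩
          2 + (1 + (3 * k + 2 * c))     ≤⟨ +-monoʳ-≤ 2 inv ⟩
          2 + 2 * ∣ N S ∣               ≡⟨ *-suc 2 ∣ N S ∣ ⟨
          2 * suc ∣ N S ∣               ≤⟨ *-monoʳ-≤ 2 (∣N∣-increases pl) ⟩
          2 * ∣ N (S ∪ ⁅ v ⁆) ∣         ∎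
          where
          open ≤-Reasoning
          eq : ∀ k c → 3 * suc k + 2 * c ≡ 2 + (1 + (3 * k + 2 * c))
          eq = solve-∀
      move : ∀ ℓ → k + ℓ ≡ K → StaCan G S ℓ
      -- Here `k = K`, so by `cap₀` no legal move can exist and the game is over.
      move zero    eq = sEnd λ v pl → <-irrefl (trans (sym (+-identityʳ k)) eq)
                          (cap₀ (suc k) _ (k< pl) (inv′ pl))
      move (suc ℓ) eq = sMove λ v pl →
        dom ℓ (suc k) _ (trans (sym (+-suc k ℓ)) eq) (k< pl) (inv′ pl)

    openAt : ∀ v → deg G v ≡ 2 + c → DomCan G ⊥ K
    openAt v deg-v = move K refl 1≤K
      where
      nbr : Nonempty (tabulate (adj G v))
      nbr = ∣p∣>0⇒Nonempty _ (≤-trans (s≤s z≤n) (≤-reflexive (sym deg-v)))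
      untouched : ∀ {u} → Rem G ⊥ u
      untouched (_ , w∈⊥ , _) = ∉⊥ w∈⊥
      pl : Playable G ⊥ v
      pl = Live⇒Playable vu (untouched , inj₁ (v , untouched , Adj-sym vu))
        where vu = ∈-tabulate⁻ (adj G v) (proj₂ nbr)
      S₁ = ⊥ ∪ ⁅ v ⁆
      1≤S₁ : 1 ≤ ∣ S₁ ∣
      1≤S₁ = ≤-trans (s≤s z≤n) (∣S∣<∣S∪v∣ pl)
      -- The opening dominates `2 + c` vertices, and twice that is exactly the bound that `sta` asks
      -- for at `k = 1`.
      inv₁ : 1 + (3 * 1 + 2 * c) ≤ 2 * ∣ N S₁ ∣
      inv₁ = begin
        4 + 2 * c         ≡⟨ *-distribˡ-+ 2 2 c ⟨
        2 * (2 + c)       ≡⟨ cong (2 *_) deg-v ⟨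
        2 * deg G v       ≤⟨ *-monoʳ-≤ 2 (p⊆q⇒∣p∣≤∣q∣
                               (∈-⟪⟫⁺ (InN? S₁) ∘ Adj⇒InN ∘ ∈-tabulate⁻ (adj G v))) ⟩
        2 * ∣ N S₁ ∣      ∎
        where open ≤-Reasoning
      1≤K : 1 ≤ K
      1≤K = cap₀ 1 S₁ 1≤S₁ (m+n≤o⇒n≤o 1 inv₁)
      move : ∀ ℓ → ℓ ≡ K → 1 ≤ K → DomCan G ⊥ ℓ
      move zero    refl ()
      move (suc ℓ) eq   _ = dMove v pl (sta ℓ 1 S₁ eq 1≤S₁ inv₁)

-- Arithmetic of the bound.

-- Supplies the budget as a rounded-down quotient: the first property gives the final inequality,
-- maximality gives `cap`.
greatest : ∀ q c N → c ≤ N → ∃ λ K →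
  suc q * K + c ≤ N × (∀ k → suc q * k + c ≤ N → k ≤ K)
greatest q c N c≤N = K , lower , upper
  where
  open ≤-Reasoning
  K = (N ∸ c) / suc q
  lower : suc q * K + c ≤ N
  lower = begin
    suc q * K + c ≡⟨ cong (_+ c) (*-comm (suc q) K) ⟩
    K * suc q + c ≤⟨ +-monoˡ-≤ c (m/n*n≤m (N ∸ c) (suc q)) ⟩
    N ∸ c + c     ≡⟨ m∸n+n≡m c≤N ⟩
    N             ∎
  upper : ∀ k → suc q * k + c ≤ N → k ≤ K
  upper k le = begin
    k                 ≡⟨ m*n/n≡m k (suc q) ⟨
    k * suc q / suc q ≤⟨ /-monoˡ-≤ (suc q) (m+n≤o⇒m≤o∸n (k * suc q)
                           (subst (λ x → x + c ≤ N) (*-comm (suc q) k) le)) ⟩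
    K                 ∎

-- The weight `e` on the domination bound puts `e * m` on both sides, so the unknown number of live
-- vertices cancels.
combine : ∀ e n c t m → 1 ≤ e → 3 * t + 2 * c ≤ 2 * n + m → t + e * m ≤ n →
  suc (3 * e) * t + c ≤ suc (2 * e) * n
combine e n c t m 1≤e dominated live = +-cancelʳ-≤ (e * m) _ _ (begin
  suc (3 * e) * t + c + e * m                 ≤⟨ +-monoˡ-≤ (e * m) (+-monoʳ-≤ (suc (3 * e) * t) c≤) ⟩
  suc (3 * e) * t + e * (2 * c) + e * m       ≡⟨ eq₁ e t c m ⟩
  e * (3 * t + 2 * c) + (t + e * m)           ≤⟨ +-mono-≤ (*-monoʳ-≤ e dominated) live ⟩
  e * (2 * n + m) + n                         ≡⟨ eq₂ e n m ⟩
  suc (2 * e) * n + e * m                     ∎)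
  where
  open ≤-Reasoning
  c≤ : c ≤ e * (2 * c)
  c≤ = ≤-trans (m≤m+n c (c + 0)) (≤-trans (≤-reflexive (sym (*-identityˡ (2 * c)))) (*-monoˡ-≤ (2 * c) 1≤e))
  eq₁ : ∀ e t c m → suc (3 * e) * t + e * (2 * c) + e * m ≡ e * (3 * t + 2 * c) + (t + e * m)
  eq₁ = solve-∀
  eq₂ : ∀ e n m → e * (2 * n + m) + n ≡ suc (2 * e) * n + e * m
  eq₂ = solve-∀

theorem3p1 : ∀ {n : ℕ} (G : Graph n) (δ Δ : ℕ) →
    3 ≤ n → Connected G → IsMinDegree G δ → IsMaxDegree G Δ → 2 ≤ δ →
    ∃ λ k → GameTotIsoAtMost G k × ((3 * δ ∸ 2) * k + (Δ ∸ 2) ≤ (2 * δ ∸ 1) * n)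
theorem3p1 {n} G (suc e) Δ _ _ (δ≤deg , _) (_ , v , deg-v) (s≤s 1≤e) =
  K , Greedy.openAt G e c K δ≤deg cap v (trans deg-v (sym 2+c≡Δ)) ,
  subst₂ (λ a b → a * K + c ≤ b * n) (sym a≡) (sym b≡) K-ok
  where
  c = Δ ∸ 2
  -- The truncated subtraction is exact, since `Δ` is at least `δ` and hence at least 2.
  2+c≡Δ : 2 + c ≡ Δ
  2+c≡Δ = m+[n∸m]≡n (≤-trans (s≤s 1≤e) (subst (suc e ≤_) deg-v (δ≤deg v)))
  c≤N : c ≤ suc (2 * e) * n
  c≤N = ≤-trans (m∸n≤m Δ 2) (≤-trans (subst (_≤ n) deg-v (∣p∣≤n (tabulate (adj G v)))) (m≤m+n n _))
  best = greatest (3 * e) c (suc (2 * e) * n) c≤N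
  K = proj₁ best
  K-ok = proj₁ (proj₂ best)
  cap : ∀ t m → 3 * t + 2 * c ≤ 2 * n + m → t + e * m ≤ n → t ≤ K
  cap t m p q = proj₂ (proj₂ best) t (combine e n c t m 1≤e p q)
  a≡ : 3 * suc e ∸ 2 ≡ suc (3 * e)
  a≡ = cong (_∸ 2) (*-suc 3 e)
  b≡ : 2 * suc e ∸ 1 ≡ suc (2 * e)
  b≡ = cong (_∸ 1) (*-suc 2 e)
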